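{- Let $G$ be the graph consisting of two distinct vertices $v,w$ and four internally vertex-disjoint paths between $v$ and $w$, where three of the paths consist of $26$ edges each and the fourth path consists of a single edge. Let $\mathrm{M}$ be the graphic matroid of $G$, let $r$ be the rank of $\mathrm{M}$, and let $W_i$ denote the number of flats of $\mathrm{M}$ of rank $i$. Then the sequence $W_0,\dots,W_r$ is not log-concave: there exists an integer $i$ with $1\le i\le r-1$ such that $W_i^2 < W_{i-1}W_{i+1}$.
   Context: The graphic matroid of a graph $G$ is the matroid on the edge set of $G$ whose independent sets are the edge sets of forests in $G$. A flat of a matroid is a subset $F$ of the ground set such that adding any element outside $F$ strictly increases the rank. -}

module Defs where

open import Data.Fin.Base using (Fin; zero; suc; inject₁; combine; remQuot)
open import Data.Fin.Properties using (all?; any?; ¬∀⟶∃¬; injective⇒≤) renaming (_≟_ to _≟ᶠ_)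
open import Data.Fin.Subset
open import Data.Fin.Subset.Properties
open import Data.List.Base as List using (List; filter; length)
open import Data.List.Extrema.Nat using (max)
open import Data.Nat.Base using (ℕ; zero; suc; _+_; _*_; _≤_; _<_; z≤n; s≤s; s≤s⁻¹)
import Data.Nat.Properties as ℕ
open import Data.Product.Base using (∃; ∃-syntax; _×_; _,_; proj₁; proj₂)
open import Data.Product.Properties using (≡-dec; ,-injective)
open import Data.Sum.Base using (_⊎_; inj₁; inj₂)
open import Data.Vec.Base as Vec using (Vec; []; _∷_; _∷ʳ_; lookup; tabulate; head; tail)
open import Data.Vec.Relation.Unary.All as All using (All; []; _∷_)
open import Data.Vec.Relation.Unary.All.Properties using (lookup⁺; lookup⁻)
open import Data.Vec.Relation.Unary.AllPairs using (allPairs?)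
open import Data.Vec.Relation.Unary.Unique.Propositional using (Unique; []; _∷_)
open import Data.Vec.Relation.Unary.Unique.Propositional.Properties using (lookup-injective)
open import Function.Base using (_∘_)
open import Level using (0ℓ)
open import Relation.Binary.PropositionalEquality
open import Relation.Nullary.Decidable using (Dec; yes; no; ¬?; map′; _×-dec_; _⊎-dec_; _→-dec_)
open import Relation.Nullary.Negation using (¬_; contradiction)
open import Relation.Unary using (Pred; Decidable)

-- Independence is required to be decidable, so that ranks and numbers of
-- flats are actual natural numbers.
record Matroid (n : ℕ) : Set₁ where
  field
    Independent  : Pred (Subset n) 0ℓ
    independent? : Decidable Independent
    ⊥-indep      : Independent ⊥
    ⊆-indep      : ∀ {I J} → I ⊆ J → Independent J → Independent I
    exchange     : ∀ {I J} → Independent I → Independent J → ∣ I ∣ < ∣ J ∣ →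
                   ∃[ e ] e ∈ J × e ∉ I × Independent (I ∪ ⁅ e ⁆)

subsets : ∀ n → List (Subset n)
subsets zero    = [] List.∷ List.[]
subsets (suc n) = List.map (outside ∷_) (subsets n) List.++ List.map (inside ∷_) (subsets n)

module _ {n} (M : Matroid n) where
  open Matroid M

  rankOf : Subset n → ℕ
  rankOf S = max 0 (List.map ∣_∣ (filter (λ I → (I ⊆? S) ×-dec independent? I) (subsets n)))

  rank : ℕ
  rank = rankOf ⊤

  Flat : Pred (Subset n) 0ℓ
  Flat F = ∀ e → e ∉ F → rankOf F < rankOf (F ∪ ⁅ e ⁆)

  flat? : Decidable Flat
  flat? F = all? λ e → ¬? (e ∈? F) →-dec (rankOf F ℕ.<? rankOf (F ∪ ⁅ e ⁆))

  W : ℕ → ℕ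
  W i = length (filter (λ F → flat? F ×-dec (rankOf F ℕ.≟ i)) (subsets n))

-- Finite undirected graphs, loops and parallel edges allowed.  The order
-- of the two components of `ends e` carries no information: it is only
-- used through `Joins`.
record Graph : Set where
  field
    #V #E : ℕ
    ends  : Fin #E → Fin #V × Fin #V

rotate : ∀ {a} {A : Set a} {n} → Vec A (suc n) → Vec A (suc n)
rotate xs = tail xs ∷ʳ head xs

module _ (G : Graph) where
  open Graph G

  Joins : Fin #E → Fin #V → Fin #V → Set
  Joins e x y = ends e ≡ (x , y) ⊎ ends e ≡ (y , x)

  -- The cycle with vertices v₀ , … , vₘ and edges e₀ , … , eₘ, where eⱼ
  -- joins vⱼ to vⱼ₊₁ and eₘ joins vₘ to v₀.  Loops (m = 0) and pairs of
  -- parallel edges (m = 1) are cycles.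
  record IsCycle (S : Subset #E) {m} (vs : Vec (Fin #V) (suc m)) (es : Vec (Fin #E) (suc m)) : Set where
    constructor mkCycle
    field
      vs-unique : Unique vs
      es-unique : Unique es
      es⊆S      : All (_∈ S) es
      joins     : ∀ j → Joins (lookup es j) (lookup vs j) (lookup (rotate vs) j)

  HasCycle : Pred (Subset #E) 0ℓ
  HasCycle S = ∃[ m ] ∃[ vs ] ∃[ es ] IsCycle S {m} vs es

  Forest : Pred (Subset #E) 0ℓ
  Forest S = ¬ HasCycle S

unique? : ∀ {n m} → Decidable (Unique {A = Fin n} {m})
unique? = allPairs? (λ x y → ¬? (x ≟ᶠ y))

anyVec? : ∀ {n p} m {P : Pred (Vec (Fin n) m) p} → Decidable P → Dec (∃ P)
anyVec? zero    P? = map′ ([] ,_) (λ { ([] , p) → p }) (P? [])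
anyVec? (suc m) P? =
  map′ (λ { (x , xs , p) → (x ∷ xs) , p }) (λ { ((x ∷ xs) , p) → x , xs , p })
       (any? λ x → anyVec? m λ xs → P? (x ∷ xs))

any<? : ∀ {p} {P : Pred ℕ p} → Decidable P → ∀ n → (∀ {m} → P m → m < n) → Dec (∃ P)
any<? {P = P} P? n bound =
  map′ (λ { (m , _ , p) → m , p }) (λ { (m , p) → m , bound p , p }) (ℕ.anyUpTo? P? n)

unique⇒≤ : ∀ {n m} {xs : Vec (Fin n) m} → Unique xs → m ≤ n
unique⇒≤ {xs = xs} u = injective⇒≤ {f = lookup xs} (lookup-injective u _ _)

module _ (G : Graph) where
  open Graph G

  joins? : ∀ e x y → Dec (Joins G e x y)
  joins? e x y = ≡-dec _≟ᶠ_ _≟ᶠ_ (ends e) (x , y) ⊎-dec ≡-dec _≟ᶠ_ _≟ᶠ_ (ends e) (y , x)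

  isCycle? : ∀ S {m} vs es → Dec (IsCycle G S {m} vs es)
  isCycle? S vs es =
    map′ (λ { (a , b , c , d) → mkCycle a b c d })
         (λ { (mkCycle a b c d) → a , b , c , d })
         (unique? vs ×-dec unique? es ×-dec All.all? (_∈? S) es
          ×-dec all? λ j → joins? (lookup es j) (lookup vs j) (lookup (rotate vs) j))

  hasCycle? : Decidable (HasCycle G)
  hasCycle? S =
    any<? (λ m → anyVec? (suc m) λ vs → anyVec? (suc m) λ es → isCycle? S vs es) #E
          (λ { (_ , _ , c) → unique⇒≤ (IsCycle.es-unique c) })

  forest? : Decidable (Forest G)
  forest? S = ¬? (hasCycle? S)

∣p∣≤1+∣p-x∣ : ∀ {n} (p : Subset n) x → ∣ p ∣ ≤ suc ∣ p - x ∣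
∣p∣≤1+∣p-x∣ (outside ∷ p) zero    = ℕ.≤-trans (ℕ.≤-reflexive (cong ∣_∣ (sym (p─⊥≡p p)))) (ℕ.n≤1+n _)
∣p∣≤1+∣p-x∣ (inside  ∷ p) zero    = s≤s (ℕ.≤-reflexive (cong ∣_∣ (sym (p─⊥≡p p))))
∣p∣≤1+∣p-x∣ (outside ∷ p) (suc x) = ∣p∣≤1+∣p-x∣ p x
∣p∣≤1+∣p-x∣ (inside  ∷ p) (suc x) = s≤s (∣p∣≤1+∣p-x∣ p x)

x∈p─q⇒x∉q : ∀ {n} {x : Fin n} (p q : Subset n) → x ∈ p ─ q → x ∉ q
x∈p─q⇒x∉q {x = zero}  (_ ∷ _) (inside  ∷ _) ()  _
x∈p─q⇒x∉q {x = zero}  (_ ∷ _) (outside ∷ _) _   ()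
x∈p─q⇒x∉q {x = suc _} (_ ∷ p) (inside  ∷ q) (Vec.there x∈) (Vec.there x∈q) = x∈p─q⇒x∉q p q x∈ x∈q
x∈p─q⇒x∉q {x = suc _} (_ ∷ p) (outside ∷ q) (Vec.there x∈) (Vec.there x∈q) = x∈p─q⇒x∉q p q x∈ x∈q

x∈p-y⇒x≢y : ∀ {n} {x y : Fin n} (p : Subset n) → x ∈ p - y → x ≢ y
x∈p-y⇒x≢y p x∈ refl = x∈p─q⇒x∉q p _ x∈ (x∈⁅x⁆ _)

x∈p∪⁅y⁆⁻ : ∀ {n} {x y : Fin n} (p : Subset n) → x ∈ p ∪ ⁅ y ⁆ → x ∈ p ⊎ x ≡ y
x∈p∪⁅y⁆⁻ {y = y} p x∈ with x∈p∪q⁻ p ⁅ y ⁆ x∈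
... | inj₁ x∈p = inj₁ x∈p
... | inj₂ x∈y = inj₂ (x∈⁅y⁆⇒x≡y y x∈y)

∷ʳ-all : ∀ {a p} {A : Set a} {P : Pred A p} {n} {xs : Vec A n} {x} → All P xs → P x → All P (xs ∷ʳ x)
∷ʳ-all []         px = px ∷ []
∷ʳ-all (py ∷ pxs) px = py ∷ ∷ʳ-all pxs px

∷ʳ-unique : ∀ {a} {A : Set a} {n} {xs : Vec A n} {x} → Unique xs → All (_≢ x) xs → Unique (xs ∷ʳ x)
∷ʳ-unique []       []       = [] ∷ []
∷ʳ-unique (p ∷ ps) (q ∷ qs) = ∷ʳ-all p q ∷ ∷ʳ-unique ps qs


module _ (G : Graph) where
  open Graph G

  private
    variable
      P Q     : Pred (Fin #E) 0ℓ
      x y z w : Fin #V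
      e       : Fin #E
      m       : ℕ

  joins-sym : Joins G e x y → Joins G e y x
  joins-sym (inj₁ p) = inj₂ p
  joins-sym (inj₂ p) = inj₁ p

  joins-ends : Joins G e x y → Joins G e z w → (x ≡ z × y ≡ w) ⊎ (x ≡ w × y ≡ z)
  joins-ends (inj₁ p) (inj₁ q) = inj₁ (,-injective (trans (sym p) q))
  joins-ends (inj₁ p) (inj₂ q) = inj₂ (,-injective (trans (sym p) q))
  joins-ends (inj₂ p) (inj₁ q) with ,-injective (trans (sym p) q)
  ... | a , b = inj₂ (b , a)
  joins-ends (inj₂ p) (inj₂ q) with ,-injective (trans (sym p) q)
  ... | a , b = inj₁ (b , a)

  data Walk (P : Pred (Fin #E) 0ℓ) : Fin #V → Fin #V → Set where
    nil  : Walk P x x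
    cons : P e → Joins G e x y → Walk P y z → Walk P x z

  _++ʷ_ : Walk P x y → Walk P y z → Walk P x z
  nil        ++ʷ v = v
  cons p j u ++ʷ v = cons p j (u ++ʷ v)

  reverseʷ : Walk P x y → Walk P y x
  reverseʷ nil          = nil
  reverseʷ (cons p j u) = reverseʷ u ++ʷ cons p (joins-sym j) nil

  bindʷ : (∀ {e x y} → P e → Joins G e x y → Walk Q x y) → Walk P x y → Walk Q x y
  bindʷ f nil          = nil
  bindʷ f (cons p j u) = f p j ++ʷ bindʷ f u

  -- A walk without repeated vertices; `xs` lists its vertices after the
  -- first one.
  data Path (P : Pred (Fin #E) 0ℓ) : Fin #V → Fin #V → Vec (Fin #V) m → Vec (Fin #E) m → Set where
    nil  : Path P x x [] []
    cons : {xs : Vec (Fin #V) m} {es : Vec (Fin #E) m} → P e → Joins G e x y →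
           All (x ≢_) (y ∷ xs) → Path P y z xs es → Path P x z (y ∷ xs) (e ∷ es)

  SomePath : Pred (Fin #E) 0ℓ → Fin #V → Fin #V → Set
  SomePath P x z = ∃[ m ] ∃[ xs ] ∃[ es ] Path P {m} x z xs es

  path-from : ∀ x {xs : Vec (Fin #V) m} {es} → Path P y z xs es → SomePath P x z ⊎ All (x ≢_) (y ∷ xs)
  path-from {y = y} x p with x ≟ᶠ y
  path-from x p              | yes refl = inj₁ (_ , _ , _ , p)
  path-from x nil            | no x≢y   = inj₂ (x≢y ∷ [])
  path-from x (cons _ _ _ p) | no x≢y   with path-from x p
  ... | inj₁ q = inj₁ q
  ... | inj₂ a = inj₂ (x≢y ∷ a)

  walk⇒path : Walk P x z → SomePath P x z
  walk⇒path nil = _ , _ , _ , nil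
  walk⇒path {x = x} (cons pe j u) with walk⇒path u
  ... | _ , _ , _ , p with path-from x p
  ...   | inj₁ q = q
  ...   | inj₂ a = _ , _ , _ , cons pe j a p

  path-vs-unique : {xs : Vec (Fin #V) m} {es : Vec (Fin #E) m} → Path P x z xs es → Unique (x ∷ xs)
  path-vs-unique nil            = [] ∷ []
  path-vs-unique (cons _ _ a p) = a ∷ path-vs-unique p

  path-edge-fresh : {xs : Vec (Fin #V) m} {es : Vec (Fin #E) m} → Joins G e x w →
                    All (x ≢_) (y ∷ xs) → Path P y z xs es → All (e ≢_) es
  path-edge-fresh j a                  nil                           = []
  path-edge-fresh j (x≢y ∷ x≢y′ ∷ a) (cons {e = e′} {y = y′} _ j′ _ p) =
    e≢e′ ∷ path-edge-fresh j (x≢y′ ∷ a) p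
    where
    e≢e′ : _ ≢ e′
    e≢e′ refl with joins-ends j j′
    ... | inj₁ (x≡y  , _) = x≢y x≡y
    ... | inj₂ (x≡y′ , _) = x≢y′ x≡y′

  path-es-unique : {xs : Vec (Fin #V) m} {es : Vec (Fin #E) m} → Path P x z xs es → Unique es
  path-es-unique nil            = []
  path-es-unique (cons _ j a p) = path-edge-fresh j a p ∷ path-es-unique p

  path-all : {xs : Vec (Fin #V) m} {es : Vec (Fin #E) m} → Path P x z xs es → All P es
  path-all nil             = []
  path-all (cons pe _ _ p) = pe ∷ path-all p

  path-joins : {xs : Vec (Fin #V) m} {es : Vec (Fin #E) m} → Path P x z xs es → Joins G e z w →
               ∀ i → Joins G (lookup (es ∷ʳ e) i) (lookup (x ∷ xs) i) (lookup (xs ∷ʳ w) i)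
  path-joins nil             j zero    = j
  path-joins (cons _ j′ _ _) j zero    = j′
  path-joins (cons _ _ _ p)  j (suc i) = path-joins p j i

  close-walk : ∀ {S} → e ∈ S → Joins G e x y → Walk (λ f → f ∈ S × f ≢ e) y x → HasCycle G S
  close-walk e∈S j u with walk⇒path u
  ... | _ , _ , _ , p = _ , _ , _ , mkCycle
    (path-vs-unique p)
    (∷ʳ-unique (path-es-unique p) (All.map proj₂ (path-all p)))
    (∷ʳ-all (All.map proj₁ (path-all p)) e∈S)
    (path-joins p j)

  Chain : Fin #V → Vec (Fin #V) m → Fin #V → Vec (Fin #E) (suc m) → Set
  Chain x xs z es = ∀ i → Joins G (lookup es i) (lookup (x ∷ xs) i) (lookup (xs ∷ʳ z) i)

  chain-walk : ∀ {x} (xs : Vec (Fin #V) m) es → Chain x xs z es → All P es → Walk P x z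
  chain-walk []       (e ∷ []) js (p ∷ [])  = cons p (js zero) nil
  chain-walk (y ∷ xs) (e ∷ es) js (p ∷ ps) = cons p (js zero) (chain-walk xs es (js ∘ suc) ps)

  before : ∀ {x} (xs : Vec (Fin #V) m) es → Chain x xs z es → Unique es → All P es → ∀ i →
           Walk (λ f → P f × f ≢ lookup es i) x (lookup (x ∷ xs) i)
  before xs       es       js u        ps       zero    = nil
  before (y ∷ xs) (e ∷ es) js (e≢ ∷ u) (p ∷ ps) (suc i) =
    cons (p , lookup⁺ e≢ i) (js zero) (before xs es (js ∘ suc) u ps i)

  after : ∀ {x} (xs : Vec (Fin #V) m) es → Chain x xs z es → Unique es → All P es → ∀ i →
          Walk (λ f → P f × f ≢ lookup es i) (lookup (xs ∷ʳ z) i) z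
  after []       es       js u        ps       zero    = nil
  after (y ∷ xs) (e ∷ es) js (e≢ ∷ u) (p ∷ ps) zero    =
    chain-walk xs es (js ∘ suc) (All.zip (ps , All.map (λ e≢f f≡e → e≢f (sym f≡e)) e≢))
  after (y ∷ xs) (e ∷ es) js (e≢ ∷ u) (p ∷ ps) (suc i) = after xs es (js ∘ suc) u ps i

  open-cycle : ∀ {S} {vs : Vec (Fin #V) (suc m)} {es} → IsCycle G S vs es → ∀ i →
               Walk (λ f → f ∈ S × f ≢ lookup es i) (lookup (rotate vs) i) (lookup vs i)
  open-cycle {vs = x ∷ xs} {es} (mkCycle _ u es⊆S js) i =
    after xs es js u es⊆S i ++ʷ before xs es js u es⊆S i

  edge-outside : ∀ {S T} {vs : Vec (Fin #V) (suc m)} {es} → IsCycle G S vs es → Forest G T →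
                 ∃[ i ] lookup es i ∉ T
  edge-outside {m = m} {T = T} {es = es} (mkCycle a b c d) forest =
    ¬∀⟶∃¬ _ _ (λ i → lookup es i ∈? T)
      λ es∈T → forest (m , _ , _ , mkCycle a b (lookup⁻ es∈T) d)

  Forest-⊥ : Forest G ⊥
  Forest-⊥ (_ , _ , _ ∷ _ , c) with IsCycle.es⊆S c
  ... | e∈⊥ ∷ _ = ∉⊥ e∈⊥

  Forest-⊆ : ∀ {I J} → I ⊆ J → Forest G J → Forest G I
  Forest-⊆ I⊆J forest (_ , _ , _ , mkCycle a b c d) = forest (_ , _ , _ , mkCycle a b (All.map I⊆J c) d)

  Forest-swap : ∀ {J f} {vs : Vec (Fin #V) (suc m)} {es} → Forest G J →
                IsCycle G (J ∪ ⁅ f ⁆) vs es → ∀ i → lookup es i ∈ J →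
                Forest G ((J ∪ ⁅ f ⁆) - lookup es i)
  Forest-swap {J = J} {f} {es = es} forest C i d∈J (_ , vs′ , es′ , C′) with edge-outside C′ forest
  ... | j , f′∉J = forest (close-walk d∈J (IsCycle.joins C i) (bindʷ step (open-cycle C i)))
    where
    d  = lookup es i
    f′ = lookup es′ j
    J′ = (J ∪ ⁅ f ⁆) - d

    f′∈J′ : f′ ∈ J′
    f′∈J′ = lookup⁺ (IsCycle.es⊆S C′) j

    f′≡f : f′ ≡ f
    f′≡f with x∈p∪⁅y⁆⁻ J (p─q⊆p (J ∪ ⁅ f ⁆) ⁅ d ⁆ f′∈J′)
    ... | inj₁ f′∈J = contradiction f′∈J f′∉J
    ... | inj₂ eq   = eq

    keep : ∀ {g x y} → g ∈ J′ × g ≢ f′ → Joins G g x y → Walk (λ h → h ∈ J × h ≢ d) x y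
    keep (g∈J′ , g≢f′) jg with x∈p∪⁅y⁆⁻ J (p─q⊆p (J ∪ ⁅ f ⁆) ⁅ d ⁆ g∈J′)
    ... | inj₁ g∈J = cons (g∈J , x∈p-y⇒x≢y (J ∪ ⁅ f ⁆) g∈J′) jg nil
    ... | inj₂ g≡f = contradiction (trans g≡f (sym f′≡f)) g≢f′

    detour : Walk (λ h → h ∈ J × h ≢ d) (lookup (rotate vs′) j) (lookup vs′ j)
    detour = bindʷ keep (open-cycle C′ j)

    step : ∀ {g x y} → g ∈ J ∪ ⁅ f ⁆ × g ≢ d → Joins G g x y → Walk (λ h → h ∈ J × h ≢ d) x y
    step (g∈ , g≢d) jg with x∈p∪⁅y⁆⁻ J g∈
    ... | inj₁ g∈J = cons (g∈J , g≢d) jg nil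
    ... | inj₂ refl with joins-ends jg (subst (λ h → Joins G h _ _) f′≡f (IsCycle.joins C′ j))
    ...   | inj₁ (refl , refl) = reverseʷ detour
    ...   | inj₂ (refl , refl) = detour

  -- Induction on a bound for ∣ I ─ J ∣: an edge f ∈ I ─ J can be moved into J,
  -- at the cost of dropping at most one edge of J ─ I.
  Forest-exchange′ : ∀ n {I J} → ∣ I ─ J ∣ < n → Forest G I → Forest G J → ∣ I ∣ < ∣ J ∣ →
                     ∃[ e ] e ∈ J × e ∉ I × Forest G (I ∪ ⁅ e ⁆)
  Forest-exchange′ (suc n) {I} {J} (s≤s bound) fI fJ I<J with any? (λ f → (f ∈? I) ×-dec ¬? (f ∈? J))
  ... | no I⊆J′ with any? (λ e → (e ∈? J) ×-dec ¬? (e ∈? I))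
  ...   | no J⊆I′ = contradiction (p⊆q⇒∣p∣≤∣q∣ J⊆I) (ℕ.<⇒≱ I<J)
    where
    J⊆I : J ⊆ I
    J⊆I {e} e∈J with e ∈? I
    ... | yes e∈I = e∈I
    ... | no e∉I  = contradiction (e , e∈J , e∉I) J⊆I′
  ...   | yes (e , e∈J , e∉I) = e , e∈J , e∉I , Forest-⊆ I+e⊆J fJ
    where
    I+e⊆J : I ∪ ⁅ e ⁆ ⊆ J
    I+e⊆J {g} g∈ with x∈p∪⁅y⁆⁻ I g∈
    ... | inj₂ refl = e∈J
    ... | inj₁ g∈I with g ∈? J
    ...   | yes g∈J = g∈J
    ...   | no g∉J  = contradiction (g , g∈I , g∉J) I⊆J′
  Forest-exchange′ (suc n) {I} {J} (s≤s bound) fI fJ I<J | yes (f , f∈I , f∉J) with hasCycle? G (J ∪ ⁅ f ⁆)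
  ... | no acyclic = restrict (Forest-exchange′ n decrease fI acyclic (ℕ.<-≤-trans I<J (∣p∣≤∣p∪q∣ J ⁅ f ⁆)))
    where
    decrease : ∣ I ─ (J ∪ ⁅ f ⁆) ∣ < n
    decrease = ℕ.<-≤-trans (p⊂q⇒∣p∣<∣q∣
      ( (λ g∈ → x∈p∧x∉q⇒x∈p─q (p─q⊆p I _ g∈) (x∈p─q⇒x∉q I _ g∈ ∘ p⊆p∪q ⁅ f ⁆))
      , f , x∈p∧x∉q⇒x∈p─q f∈I f∉J , λ f∈ → x∈p─q⇒x∉q I _ f∈ (q⊆p∪q J _ (x∈⁅x⁆ f)))) bound

    restrict : ∃[ e ] e ∈ J ∪ ⁅ f ⁆ × e ∉ I × Forest G (I ∪ ⁅ e ⁆) → ∃[ e ] e ∈ J × e ∉ I × Forest G (I ∪ ⁅ e ⁆)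
    restrict (e , e∈ , e∉I , fe) with x∈p∪⁅y⁆⁻ J e∈
    ... | inj₁ e∈J  = e , e∈J , e∉I , fe
    ... | inj₂ refl = contradiction f∈I e∉I
  ... | yes (_ , _ , es , C) with edge-outside C fI
  ...   | i , d∉I = restrict (Forest-exchange′ n decrease fI (Forest-swap fJ C i d∈J) (ℕ.<-≤-trans I<J J≤J′))
    where
    d = lookup es i

    d≢f : d ≢ f
    d≢f d≡f = d∉I (subst (_∈ I) (sym d≡f) f∈I)

    d∈J : d ∈ J
    d∈J with x∈p∪⁅y⁆⁻ J (lookup⁺ (IsCycle.es⊆S C) i)
    ... | inj₁ d∈J = d∈J
    ... | inj₂ d≡f = contradiction d≡f d≢f

    J′ = (J ∪ ⁅ f ⁆) - d

    J≤J′ : ∣ J ∣ ≤ ∣ J′ ∣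
    J≤J′ = s≤s⁻¹ (ℕ.≤-trans
      (p⊂q⇒∣p∣<∣q∣ (p⊆p∪q ⁅ f ⁆ , f , q⊆p∪q J _ (x∈⁅x⁆ f) , f∉J))
      (∣p∣≤1+∣p-x∣ (J ∪ ⁅ f ⁆) d))

    f∈J′ : f ∈ J′
    f∈J′ = x∈p∧x≢y⇒x∈p-y (q⊆p∪q J _ (x∈⁅x⁆ f)) (d≢f ∘ sym)

    ∈J⇒∈J′ : ∀ {g} → g ∈ I → g ∈ J → g ∈ J′
    ∈J⇒∈J′ g∈I g∈J = x∈p∧x≢y⇒x∈p-y (p⊆p∪q ⁅ f ⁆ g∈J) λ g≡d → d∉I (subst (_∈ I) g≡d g∈I)

    decrease : ∣ I ─ J′ ∣ < n
    decrease = ℕ.<-≤-trans (p⊂q⇒∣p∣<∣q∣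
      ( (λ g∈ → x∈p∧x∉q⇒x∈p─q (p─q⊆p I _ g∈) (x∈p─q⇒x∉q I _ g∈ ∘ ∈J⇒∈J′ (p─q⊆p I _ g∈)))
      , f , x∈p∧x∉q⇒x∈p─q f∈I f∉J , λ f∈ → x∈p─q⇒x∉q I _ f∈ f∈J′)) bound

    restrict : ∃[ e ] e ∈ J′ × e ∉ I × Forest G (I ∪ ⁅ e ⁆) → ∃[ e ] e ∈ J × e ∉ I × Forest G (I ∪ ⁅ e ⁆)
    restrict (e , e∈ , e∉I , fe) with x∈p∪⁅y⁆⁻ J (p─q⊆p (J ∪ ⁅ f ⁆) _ e∈)
    ... | inj₁ e∈J  = e , e∈J , e∉I , fe
    ... | inj₂ refl = contradiction f∈I e∉I

  Forest-exchange : ∀ {I J} → Forest G I → Forest G J → ∣ I ∣ < ∣ J ∣ →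
                    ∃[ e ] e ∈ J × e ∉ I × Forest G (I ∪ ⁅ e ⁆)
  Forest-exchange = Forest-exchange′ _ ℕ.≤-refl

graphicMatroid : (G : Graph) → Matroid (Graph.#E G)
graphicMatroid G = record
  { Independent  = Forest G
  ; independent? = forest? G
  ; ⊥-indep      = Forest-⊥ G
  ; ⊆-indep      = Forest-⊆ G
  ; exchange     = Forest-exchange G
  }

-- Two vertices v, w joined by a single edge and by m further internally
-- vertex-disjoint paths, each with k internal vertices, hence with k + 1
-- edges.
module _ (m k : ℕ) where

  private
    v w : Fin (2 + m * k)
    v = zero
    w = suc zero

    internal : Fin m → Fin k → Fin (2 + m * k)
    internal p j = suc (suc (combine p j))

  pathVertices : Fin m → Vec (Fin (2 + m * k)) (2 + k)
  pathVertices p = v ∷ (tabulate (internal p) ∷ʳ w)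

  -- Edge zero is the single edge; edge suc (combine p j) is the j-th edge
  -- of the p-th path.
  thetaEnds : Fin (1 + m * suc k) → Fin (2 + m * k) × Fin (2 + m * k)
  thetaEnds zero    = v , w
  thetaEnds (suc e) with remQuot {m} (suc k) e
  ... | p , j = lookup (pathVertices p) (inject₁ j) , lookup (pathVertices p) (suc j)

  thetaGraph : Graph
  thetaGraph = record { #V = 2 + m * k ; #E = 1 + m * suc k ; ends = thetaEnds }

{-# OPTIONS --safe #-}
module Submission where

-- Let the m long paths have k + 1 edges each, and let a set of edges contain
-- s₁ , … , sₘ edges of them.  A set of edges is a forest unless it contains two
-- of the m + 1 paths; each edge of such a forest is a bridge, as an explicit cut
-- shows.  Hence the rank of a set with the single edge is 1 + ∑ min(sₚ , k), and
-- this set is a flat iff no sₚ equals k; a set without the single edge is a flat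
-- iff no sₚ equals k + 1, and then it is independent.  So the generating function
-- of W is A(x)ᵐ + x B(x)ᵐ with A = (1 + x)ᵏ⁺¹ − xᵏ⁺¹ and
-- B = (1 + x)ᵏ⁺¹ − (k + 1) xᵏ − xᵏ⁺¹ + xᵏ.  For m = 3 and k = 25 the rank is 76 and
-- W₇₃ = 52954525, W₇₄ = 983775, W₇₅ = 18551, so log-concavity fails at i = 74.

open import Defs
open import Data.Nat using (_≤_; _<_; _*_; _+_; _∸_; _^_)
open import Data.Product using (_×_; ∃-syntax)
open import Data.Bool.Base using (Bool; true; false; _∧_; _xor_; if_then_else_)
open import Data.Bool.Properties using (not-¬; ∧-zeroʳ)
open import Data.Fin.Base using (Fin; zero; suc; toℕ; inject₁; combine; remQuot)
open import Data.Fin.Properties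
  using (all?; ¬∀⟶∃¬; toℕ-injective; toℕ-inject₁; toℕ≤pred[n]; remQuot-combine; combine-surjective; combine-injective; suc-injective)
  renaming (_≟_ to _≟ᶠ_)
open import Data.Fin.Subset
open import Data.Fin.Subset.Properties
open import Data.List.Base as List using (List; filter; length)
open import Data.List.Extrema.Nat using (max≤v⁺; v≤max⁺)
open import Data.List.Membership.Propositional using () renaming (_∈_ to _∈ˡ_)
open import Data.List.Membership.Propositional.Properties
  using (∈-++⁺ˡ; ∈-++⁺ʳ; ∈-map⁺; ∈-filter⁺)
import Data.List.Properties as List
import Data.List.Relation.Unary.All as AllList
import Data.List.Relation.Unary.All.Properties as AllList
import Data.List.Relation.Unary.Any as AnyList
import Data.List.Relation.Unary.Any.Properties as AnyList
open import Data.Nat.Base using (ℕ; zero; suc; z≤n; s≤s; _⊓_; _<ᵇ_)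
open import Data.Nat.Combinatorics using (_C_; nCk+nC[k+1]≡[n+1]C[k+1])
import Data.Nat.Properties as ℕ
open import Data.Product.Base using (_,_; proj₁; proj₂)
open import Data.Sum.Base using (_⊎_; inj₁; inj₂)
open import Data.Vec.Base using (Vec; []; _∷_; _∷ʳ_; _++_; concat; group; lookup; tabulate; here; there)
open import Data.Vec.Properties
  using (lookup∘tabulate; tabulate∘lookup; tabulate-cong; lookup-concat; lookup-++ˡ; lookup-++ʳ; lookup⇒[]=; []=⇒lookup)
import Data.Vec.Relation.Unary.All.Properties as All
open import Function.Base using (_∘_)
open import Level using (0ℓ)
open import Relation.Binary.PropositionalEquality hiding (J)
open import Relation.Nullary.Decidable using (Dec; yes; no; does; ¬?; _×-dec_; dec-true)
open import Relation.Nullary.Negation using (¬_; contradiction)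
open import Relation.Unary using (Pred; Decidable)

open import Algebra.Properties.CommutativeMonoid.Sum ℕ.+-0-commutativeMonoid
  using (sum; ∑-distrib-+; sum-cong-≗)

-- Matroids

∈-subsets : ∀ {n} (S : Subset n) → S ∈ˡ subsets n
∈-subsets []            = AnyList.here refl
∈-subsets (outside ∷ S) = ∈-++⁺ˡ (∈-map⁺ _ (∈-subsets S))
∈-subsets (inside  ∷ S) = ∈-++⁺ʳ _ (∈-map⁺ _ (∈-subsets S))

module _ {n} (M : Matroid n) where
  open Matroid M

  rankOf-lower : ∀ {I S} → I ⊆ S → Independent I → ∣ I ∣ ≤ rankOf M S
  rankOf-lower {I} {S} I⊆S indep = v≤max⁺ 0 _ (inj₂ (AnyList.map⁺
    (AnyList.map (λ { refl → ℕ.≤-refl }) (∈-filter⁺ (λ J → (J ⊆? S) ×-dec independent? J) (∈-subsets I) (I⊆S , indep)))))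

  rankOf-upper : ∀ {S r} → (∀ {I} → I ⊆ S → Independent I → ∣ I ∣ ≤ r) → rankOf M S ≤ r
  rankOf-upper {S} bound = max≤v⁺ z≤n (AllList.map⁺ (AllList.map (λ { (I⊆S , indep) → bound I⊆S indep })
    (AllList.all-filter (λ J → (J ⊆? S) ×-dec independent? J) (subsets n))))

  -- By exchange, a larger independent subset of `S` would supply an element of `S` extending `I`,
  -- so a maximal independent subset already realises the rank.
  rankOf-basis : ∀ {I S} → I ⊆ S → Independent I →
                 (∀ {e} → e ∈ S → e ∉ I → ¬ Independent (I ∪ ⁅ e ⁆)) → rankOf M S ≡ ∣ I ∣
  rankOf-basis {I} {S} I⊆S indep maximal = ℕ.≤-antisym (rankOf-upper bound) (rankOf-lower I⊆S indep)
    where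
    bound : ∀ {J} → J ⊆ S → Independent J → ∣ J ∣ ≤ ∣ I ∣
    bound J⊆S indepJ = ℕ.≮⇒≥ λ I<J → let e , e∈J , e∉I , indep′ = exchange indep indepJ I<J
                                      in maximal (J⊆S e∈J) e∉I indep′

  rankOf-indep : ∀ {I} → Independent I → rankOf M I ≡ ∣ I ∣
  rankOf-indep indep = rankOf-basis (λ x → x) indep λ e∈ e∉ → contradiction e∈ e∉

-- Sums, sizes and blocks of subsets

sum-mono-≤ : ∀ {n} {f g : Fin n → ℕ} → (∀ i → f i ≤ g i) → sum f ≤ sum g
sum-mono-≤ {zero}  f≤g = z≤n
sum-mono-≤ {suc n} f≤g = ℕ.+-mono-≤ (f≤g zero) (sum-mono-≤ (f≤g ∘ suc))

sum-mono-< : ∀ {n} {f g : Fin n → ℕ} → (∀ i → f i ≤ g i) → ∀ {i} → f i < g i → sum f < sum g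
sum-mono-< f≤g {zero}  fi<gi = ℕ.+-mono-<-≤ fi<gi (sum-mono-≤ (f≤g ∘ suc))
sum-mono-< f≤g {suc i} fi<gi = ℕ.+-mono-≤-< (f≤g zero) (sum-mono-< (f≤g ∘ suc) fi<gi)

sum-zero : ∀ {n} {f : Fin n → ℕ} → (∀ i → f i ≡ 0) → sum f ≡ 0
sum-zero {zero}  f≡0 = refl
sum-zero {suc n} f≡0 = cong₂ _+_ (f≡0 zero) (sum-zero (f≡0 ∘ suc))

∣p++q∣≡∣p∣+∣q∣ : ∀ {m n} (p : Subset m) (q : Subset n) → ∣ p ++ q ∣ ≡ ∣ p ∣ + ∣ q ∣
∣p++q∣≡∣p∣+∣q∣ []            q = refl
∣p++q∣≡∣p∣+∣q∣ (outside ∷ p) q = ∣p++q∣≡∣p∣+∣q∣ p q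
∣p++q∣≡∣p∣+∣q∣ (inside  ∷ p) q = cong suc (∣p++q∣≡∣p∣+∣q∣ p q)

∣p∪⁅x⁆∣≡1+∣p∣ : ∀ {n} (p : Subset n) {x} → x ∉ p → ∣ p ∪ ⁅ x ⁆ ∣ ≡ suc ∣ p ∣
∣p∪⁅x⁆∣≡1+∣p∣ (outside ∷ p) {zero}  x∉p = cong (suc ∘ ∣_∣) (∪-identityʳ p)
∣p∪⁅x⁆∣≡1+∣p∣ (inside  ∷ p) {zero}  x∉p = contradiction here x∉p
∣p∪⁅x⁆∣≡1+∣p∣ (outside ∷ p) {suc x} x∉p = ∣p∪⁅x⁆∣≡1+∣p∣ p (x∉p ∘ there)
∣p∪⁅x⁆∣≡1+∣p∣ (inside  ∷ p) {suc x} x∉p = cong suc (∣p∪⁅x⁆∣≡1+∣p∣ p (x∉p ∘ there))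

∣p∣≢n⇒missing : ∀ {n} {p : Subset n} → ∣ p ∣ ≢ n → ∃[ x ] x ∉ p
∣p∣≢n⇒missing {n} {p} ∣p∣≢n = ¬∀⟶∃¬ _ _ (_∈? p) λ all∈ →
  ∣p∣≢n (trans (cong ∣_∣ (⊆-antisym ⊆⊤ λ {x} _ → all∈ x)) (∣⊤∣≡n n))

missing⇒∣p∣<n : ∀ {n} {p : Subset n} {x} → x ∉ p → ∣ p ∣ < n
missing⇒∣p∣<n {n} {p} x∉p = subst (∣ p ∣ <_) (∣⊤∣≡n n) (p⊂q⇒∣p∣<∣q∣ (⊆⊤ , _ , ∈⊤ , x∉p))

-- Indexed through `combine` to match `thetaEnds`: once edge zero is dropped, block `p` of an edge
-- set is its trace on the long path `p`.
block : ∀ {m n} → Fin m → Subset (m * n) → Subset n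
block p R = tabulate λ j → lookup R (combine p j)

module _ {m n} (R : Subset (m * n)) (p : Fin m) {j : Fin n} where

  ∈-block⁺ : combine p j ∈ R → j ∈ block p R
  ∈-block⁺ e∈R = lookup⇒[]= j _ (trans (lookup∘tabulate _ j) ([]=⇒lookup e∈R))

  ∈-block⁻ : j ∈ block p R → combine p j ∈ R
  ∈-block⁻ j∈ = lookup⇒[]= _ R (trans (sym (lookup∘tabulate _ j)) ([]=⇒lookup j∈))

block-⊆ : ∀ {m n} {R T : Subset (m * n)} → R ⊆ T → ∀ p → block {m} p R ⊆ block p T
block-⊆ {R = R} {T} R⊆T p j∈ = ∈-block⁺ T p (R⊆T (∈-block⁻ R p j∈))

block-concat : ∀ {m n} (bs : Vec (Subset n) m) p → block p (concat bs) ≡ lookup bs p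
block-concat bs p = trans (tabulate-cong (lookup-concat bs p)) (tabulate∘lookup _)

block-zero-++ : ∀ {m n} (a : Subset n) (R : Subset (m * n)) → block {suc m} zero (a ++ R) ≡ a
block-zero-++ a R = trans (tabulate-cong (lookup-++ˡ a R)) (tabulate∘lookup a)

block-suc-++ : ∀ {m n} (a : Subset n) (R : Subset (m * n)) p → block {suc m} (suc p) (a ++ R) ≡ block p R
block-suc-++ a R p = tabulate-cong λ j → lookup-++ʳ a R (combine p j)

∣concat∣ : ∀ {m n} (bs : Vec (Subset n) m) → ∣ concat bs ∣ ≡ sum λ p → ∣ lookup bs p ∣
∣concat∣ []       = refl
∣concat∣ (b ∷ bs) = trans (∣p++q∣≡∣p∣+∣q∣ b (concat bs)) (cong (∣ b ∣ +_) (∣concat∣ bs))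

∣R∣≡∑∣block∣ : ∀ {m n} (R : Subset (m * n)) → ∣ R ∣ ≡ sum λ p → ∣ block {m} p R ∣
∣R∣≡∑∣block∣ {m} {n} R with group m n R
... | bs , refl = trans (∣concat∣ bs) (sum-cong-≗ λ p → cong ∣_∣ (sym (block-concat bs p)))

-- Cuts

module _ (G : Graph) where
  open Graph G

  -- Certifies that no cycle inside `S` passes through `e`: the other edges of the cycle would have
  -- to connect the two sides.
  record Cut (S : Subset #E) (e : Fin #E) : Set where
    constructor mkCut
    field
      side      : Fin #V → Bool
      crosses   : side (proj₁ (ends e)) ≢ side (proj₂ (ends e))
      otherwise : ∀ f → f ∈ S → f ≢ e → side (proj₁ (ends f)) ≡ side (proj₂ (ends f))

  joins-side : ∀ {e x y} {A : Set} (side : Fin #V → A) → Joins G e x y →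
               (side x ≡ side y → side (proj₁ (ends e)) ≡ side (proj₂ (ends e))) ×
               (side (proj₁ (ends e)) ≡ side (proj₂ (ends e)) → side x ≡ side y)
  joins-side side (inj₁ eq) rewrite eq = (λ x → x) , (λ x → x)
  joins-side side (inj₂ eq) rewrite eq = sym , sym

  walk-side : ∀ {P : Pred (Fin #E) 0ℓ} {A : Set} (side : Fin #V → A) →
              (∀ f → P f → side (proj₁ (ends f)) ≡ side (proj₂ (ends f))) →
              ∀ {x y} → Walk G P x y → side x ≡ side y
  walk-side side pres nil          = refl
  walk-side side pres (cons p j u) = trans (proj₂ (joins-side side j) (pres _ p)) (walk-side side pres u)

  -- Opening a cycle at its first edge leaves a walk between the ends of that edge which never
  -- changes side, although these ends lie on different sides.
  cuts⇒forest : ∀ {S} → (∀ e → e ∈ S → Cut S e) → Forest G S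
  cuts⇒forest cut (m , _ , es , cycle) with cut (lookup es zero) (All.lookup⁺ (IsCycle.es⊆S cycle) zero)
  ... | mkCut side crosses otherwise = crosses (proj₁ (joins-side side (IsCycle.joins cycle zero))
    (sym (walk-side side (λ { f (f∈S , f≢e) → otherwise f f∈S f≢e }) (open-cycle G cycle zero))))

-- Since `suc i <ᵇ suc j` reduces to `i <ᵇ j`, the labelling `λ t → t <ᵇ suc j` of the vertices of a
-- path can change only across edge `j`.
<ᵇ-suc : ∀ {i j} → i ≢ j → (i <ᵇ suc j) ≡ (i <ᵇ j)
<ᵇ-suc {zero}  {zero}  i≢j = contradiction refl i≢j
<ᵇ-suc {zero}  {suc j} i≢j = refl
<ᵇ-suc {suc i} {zero}  i≢j = refl
<ᵇ-suc {suc i} {suc j} i≢j = <ᵇ-suc (i≢j ∘ cong suc)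

n<ᵇ1+n : ∀ n → (n <ᵇ suc n) ≡ true
n<ᵇ1+n zero    = refl
n<ᵇ1+n (suc n) = n<ᵇ1+n n

n≮ᵇm : ∀ {m n} → m ≤ n → (n <ᵇ m) ≡ false
n≮ᵇm {n = zero}  z≤n     = refl
n≮ᵇm {n = suc n} z≤n     = refl
n≮ᵇm             (s≤s p) = n≮ᵇm p

lookup-tabulate-∷ʳ : ∀ {A B : Set} (φ : A → B) (g : ℕ → B) {n} {f : Fin n → A} {x} →
                     (∀ j → φ (f j) ≡ g (toℕ j)) → φ x ≡ g n →
                     ∀ t → φ (lookup (tabulate f ∷ʳ x) t) ≡ g (toℕ t)
lookup-tabulate-∷ʳ φ g {zero}  φf φx zero    = φx
lookup-tabulate-∷ʳ φ g {suc n} φf φx zero    = φf zero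
lookup-tabulate-∷ʳ φ g {suc n} φf φx (suc t) = lookup-tabulate-∷ʳ φ (g ∘ suc) (φf ∘ suc) φx t

lookup-∷ʳ-inject₁ : ∀ {A : Set} {n} (xs : Vec A n) x j → lookup (xs ∷ʳ x) (inject₁ j) ≡ lookup xs j
lookup-∷ʳ-inject₁ (y ∷ xs) x zero    = refl
lookup-∷ʳ-inject₁ (y ∷ xs) x (suc j) = lookup-∷ʳ-inject₁ xs x j

-- Theta graphs

module _ {m k : ℕ} where

  private
    G : Graph
    G = thetaGraph m k

  edge : Fin m → Fin (suc k) → Fin (1 + m * suc k)
  edge p j = suc (combine p j)

  data EdgeView : Fin (1 + m * suc k) → Set where
    single : EdgeView zero
    onPath : ∀ p j → EdgeView (edge p j)

  edgeView : ∀ e → EdgeView e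
  edgeView zero    = single
  edgeView (suc e) with combine-surjective {m} {suc k} e
  ... | p , j , refl = onPath p j

  edge-injective : ∀ {p q j i} → edge p j ≡ edge q i → p ≡ q × j ≡ i
  edge-injective {p} {q} {j} {i} = combine-injective p j q i ∘ suc-injective

  thetaEnds-edge : ∀ p j → thetaEnds m k (edge p j) ≡
                   (lookup (pathVertices m k p) (inject₁ j) , lookup (pathVertices m k p) (suc j))
  thetaEnds-edge p j = cong (λ (p , j) → lookup (pathVertices m k p) (inject₁ j) , lookup (pathVertices m k p) (suc j))
    (remQuot-combine p j)

  module _ (a b : Bool) (h : Fin m → ℕ → Bool) where

    -- Labels v by a, w by b and the t-th vertex of path p by h p t.
    label : Fin (2 + m * k) → Bool
    label zero          = a
    label (suc zero)    = b
    label (suc (suc x)) = let p , j = remQuot {m} k x in h p (suc (toℕ j))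

    -- All paths share v and w, so their labellings must agree at positions 0 and `suc k`.
    module _ (h-v : ∀ p → a ≡ h p 0) (h-w : ∀ p → b ≡ h p (suc k)) where

      label-vertex : ∀ p t → label (lookup (pathVertices m k p) t) ≡ h p (toℕ t)
      label-vertex p zero    = h-v p
      label-vertex p (suc t) = lookup-tabulate-∷ʳ label (h p ∘ suc) internal (h-w p) t
        where
        internal : ∀ j → label (suc (suc (combine p j))) ≡ h p (suc (toℕ j))
        internal j = cong (λ (p , j) → h p (suc (toℕ j))) (remQuot-combine p j)

      label-edge : ∀ p j → (label (proj₁ (thetaEnds m k (edge p j))) ≡ h p (toℕ j)) ×
                           (label (proj₂ (thetaEnds m k (edge p j))) ≡ h p (suc (toℕ j)))
      label-edge p j =
        trans (cong (label ∘ proj₁) (thetaEnds-edge p j)) (trans (label-vertex p (inject₁ j)) (cong (h p) (toℕ-inject₁ j))) ,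
        trans (cong (label ∘ proj₂) (thetaEnds-edge p j)) (label-vertex p (suc j))

      label-crosses : ∀ p j → h p (toℕ j) ≢ h p (suc (toℕ j)) →
                      label (proj₁ (thetaEnds m k (edge p j))) ≢ label (proj₂ (thetaEnds m k (edge p j)))
      label-crosses p j ne eq = let e₁ , e₂ = label-edge p j in ne (trans (sym e₁) (trans eq e₂))

      label-preserved : ∀ p j → h p (toℕ j) ≡ h p (suc (toℕ j)) →
                        label (proj₁ (thetaEnds m k (edge p j))) ≡ label (proj₂ (thetaEnds m k (edge p j)))
      label-preserved p j eq = let e₁ , e₂ = label-edge p j in trans e₁ (trans eq (sym e₂))

  Missing : Subset (1 + m * suc k) → Fin m → Set
  Missing S p = ∃[ j ] edge p j ∉ S

  module _ (J : Fin m → Fin (suc k)) where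

    private
      h : Fin m → ℕ → Bool
      h p t = t <ᵇ suc (toℕ (J p))

    -- Separates v from w at edge J p of each path p.
    separation : Fin (2 + m * k) → Bool
    separation = label true false h

    private
      h-w : ∀ p → false ≡ h p (suc k)
      h-w p = sym (n≮ᵇm (toℕ≤pred[n] (J p)))

    separation-crosses : ∀ p → separation (proj₁ (thetaEnds m k (edge p (J p)))) ≢
                               separation (proj₂ (thetaEnds m k (edge p (J p))))
    separation-crosses p = label-crosses true false h (λ _ → refl) h-w p (J p) λ eq →
      contradiction (trans (sym (n<ᵇ1+n (toℕ (J p)))) (trans eq (n≮ᵇm (ℕ.≤-refl {toℕ (J p)})))) λ ()

    separation-preserved : ∀ p j → j ≢ J p → separation (proj₁ (thetaEnds m k (edge p j))) ≡
                                             separation (proj₂ (thetaEnds m k (edge p j)))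
    separation-preserved p j j≢ = label-preserved true false h (λ _ → refl) h-w p j (<ᵇ-suc (j≢ ∘ toℕ-injective))

  -- The vertices of path p between its edges i and j.
  segment-cut : ∀ {S} p {i j} → edge p i ∈ S → edge p j ∉ S → Cut G S (edge p i)
  segment-cut {S} p {i} {j} i∈S j∉S = mkCut (label false false h) crosses otherwise
    where
    i≢j : i ≢ j
    i≢j refl = j∉S i∈S

    -- The exclusive or of the two thresholds marks the segment whichever of `i` and `j` comes
    -- first.
    h′ : ℕ → Bool
    h′ t = (t <ᵇ suc (toℕ i)) xor (t <ᵇ suc (toℕ j))

    h : Fin m → ℕ → Bool
    h q t = does (q ≟ᶠ p) ∧ h′ t

    h-v : ∀ q → false ≡ h q 0
    h-v q = sym (∧-zeroʳ _)

    h-w : ∀ q → false ≡ h q (suc k)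
    h-w q rewrite n≮ᵇm (toℕ≤pred[n] i) | n≮ᵇm (toℕ≤pred[n] j) = sym (∧-zeroʳ _)

    h′-crosses : h′ (toℕ i) ≢ h′ (suc (toℕ i))
    h′-crosses rewrite n<ᵇ1+n (toℕ i) | n≮ᵇm (ℕ.≤-refl {toℕ i}) | <ᵇ-suc (i≢j ∘ toℕ-injective) =
      not-¬ refl ∘ sym

    crosses : label false false h (proj₁ (thetaEnds m k (edge p i))) ≢
              label false false h (proj₂ (thetaEnds m k (edge p i)))
    crosses = label-crosses false false h h-v h-w p i λ eq →
      h′-crosses (subst (λ b → b ∧ h′ (toℕ i) ≡ b ∧ h′ (suc (toℕ i))) (dec-true (p ≟ᶠ p) refl) eq)

    preserved : ∀ q l → edge q l ∈ S → edge q l ≢ edge p i → h q (toℕ l) ≡ h q (suc (toℕ l))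
    preserved q l l∈S l≢i with q ≟ᶠ p
    ... | no _     = refl
    ... | yes refl = cong₂ _xor_ (<ᵇ-suc λ eq → l≢i (cong (edge p) (toℕ-injective eq)))
                                 (<ᵇ-suc λ eq → j∉S (subst (λ x → edge p x ∈ S) (toℕ-injective eq) l∈S))

    otherwise : ∀ f → f ∈ S → f ≢ edge p i → label false false h (proj₁ (thetaEnds m k f)) ≡
                                             label false false h (proj₂ (thetaEnds m k f))
    otherwise f f∈S f≢ with edgeView f
    ... | single     = refl
    ... | onPath q l = label-preserved false false h h-v h-w q l (preserved q l f∈S f≢)

  -- The single edge is a bridge by the separation through one missing edge of each path; an edge of
  -- a path is a bridge by the segment between it and the missing edge of that path.
  missing-all⇒forest : ∀ {S} → (∀ p → Missing S p) → Forest G S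
  missing-all⇒forest {S} miss = cuts⇒forest G cut
    where
    J : Fin m → Fin (suc k)
    J p = proj₁ (miss p)

    otherwise : ∀ f → f ∈ S → f ≢ zero → separation J (proj₁ (thetaEnds m k f)) ≡
                                         separation J (proj₂ (thetaEnds m k f))
    otherwise f f∈S f≢ with edgeView f
    ... | single     = contradiction refl f≢
    ... | onPath q l = separation-preserved J q l λ { refl → proj₂ (miss q) f∈S }

    cut : ∀ e → e ∈ S → Cut G S e
    cut e e∈S with edgeView e
    ... | single     = mkCut (separation J) (λ ()) otherwise
    ... | onPath p j = segment-cut p e∈S (proj₂ (miss p))

  -- Without the single edge one path `p` may be complete: edge `j` of `p` is a bridge by the
  -- separation that cuts `p` at `j` and every other path at a missing edge.
  missing-others⇒forest : ∀ {S} p → zero ∉ S → (∀ q → q ≢ p → Missing S q) → Forest G S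
  missing-others⇒forest {S} p z∉S miss = cuts⇒forest G cut
    where
    module _ (j : Fin (suc k)) where
      -- The decision is an argument so that `avoids` can match on it.
      gap : ∀ q → Dec (q ≡ p) → Fin (suc k)
      gap q (yes _)  = j
      gap q (no q≢p) = proj₁ (miss q q≢p)

      gaps : Fin m → Fin (suc k)
      gaps q = gap q (q ≟ᶠ p)

      avoids : ∀ q d → edge q (gap q d) ∈ S → edge q (gap q d) ≡ edge p j
      avoids q (yes refl) _ = refl
      avoids q (no q≢p)   e = contradiction e (proj₂ (miss q q≢p))

      gaps-p : gaps p ≡ j
      gaps-p with p ≟ᶠ p
      ... | yes _  = refl
      ... | no p≢p = contradiction refl p≢p

      otherwise : ∀ f → f ∈ S → f ≢ edge p j → separation gaps (proj₁ (thetaEnds m k f)) ≡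
                                               separation gaps (proj₂ (thetaEnds m k f))
      otherwise f f∈S f≢ with edgeView f
      ... | single     = contradiction f∈S z∉S
      ... | onPath q l = separation-preserved gaps q l λ { refl → f≢ (avoids q (q ≟ᶠ p) f∈S) }

    cut : ∀ e → e ∈ S → Cut G S e
    cut e e∈S with edgeView e
    ... | single = contradiction e∈S z∉S
    ... | onPath q j with q ≟ᶠ p
    ...   | no q≢p   = segment-cut q e∈S (proj₂ (miss q q≢p))
    ...   | yes refl = mkCut (separation (gaps j))
      (subst (λ i → separation (gaps j) (proj₁ (thetaEnds m k (edge p i))) ≢
                    separation (gaps j) (proj₂ (thetaEnds m k (edge p i)))) (gaps-p j) (separation-crosses (gaps j) p))
      (otherwise j)

  -- The path, walked back from w to v, avoids the single edge, which closes it up.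
  full-path⇒cycle : ∀ {S} p → zero ∈ S → (∀ j → edge p j ∈ S) → HasCycle G S
  full-path⇒cycle {S} p z∈S full = close-walk G z∈S (inj₁ refl) (reverseʷ G
    (chain-walk G internals (tabulate (edge p)) chain (All.tabulate⁺ λ j → full j , λ ())))
    where
    internals : Vec (Fin (2 + m * k)) k
    internals = tabulate λ j → suc (suc (combine p j))

    chain : Chain G zero internals (suc zero) (tabulate (edge p))
    chain j = subst (λ e → Joins G e (lookup (zero ∷ internals) j) (lookup (internals ∷ʳ suc zero) j))
      (sym (lookup∘tabulate (edge p) j))
      (inj₁ (trans (thetaEnds-edge p j) (cong (_, lookup (internals ∷ʳ suc zero) j)
        (lookup-∷ʳ-inject₁ (zero ∷ internals) (suc zero) j))))

-- Ranks and flats of theta graphs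

-- The trace on one path of a basis containing the single edge. By `fill`, restoring an omitted edge
-- of `a` completes the path, which makes the basis maximal.
record Trimming {k} (a : Subset (suc k)) : Set where
  constructor mkTrimming
  field
    trim : Subset (suc k)
    ⊆a   : trim ⊆ a
    size : ∣ trim ∣ ≡ ∣ a ∣ ⊓ k
    gap  : ∃[ x ] x ∉ trim
    fill : ∀ {x} → x ∈ a → x ∉ trim → ∀ y → y ≡ x ⊎ y ∈ trim

trimming : ∀ {k} (a : Subset (suc k)) → Trimming a
trimming {k} a with ∣ a ∣ ℕ.≟ suc k
... | no ∣a∣≢ = mkTrimming a (λ x → x) (sym (ℕ.m≤n⇒m⊓n≡m (ℕ.≤-pred (missing⇒∣p∣<n (proj₂ gap))))) gap
                           (λ x∈a x∉a → contradiction x∈a x∉a)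
  where gap = ∣p∣≢n⇒missing ∣a∣≢
-- Only a full path has to give up an edge; the first one is dropped.
... | yes ∣a∣≡ rewrite ∣p∣≡n⇒p≡⊤ {p = a} ∣a∣≡ = mkTrimming (outside ∷ ⊤) (λ _ → ∈⊤) size (zero , λ ()) fill
  where
  size : ∣ ⊤ {k} ∣ ≡ suc ∣ ⊤ {k} ∣ ⊓ k
  size rewrite ∣⊤∣≡n k = sym (ℕ.m≥n⇒m⊓n≡n (ℕ.n≤1+n k))

  fill : ∀ {x} → x ∈ ⊤ → x ∉ outside ∷ ⊤ → ∀ y → y ≡ x ⊎ y ∈ outside ∷ ⊤
  fill {zero}  _ _  zero    = inj₁ refl
  fill {zero}  _ _  (suc y) = inj₂ (there ∈⊤)
  fill {suc x} _ x∉ y       = contradiction (there ∈⊤) x∉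

module _ {m k : ℕ} where

  path : Fin m → Subset (m * suc k) → Subset (suc k)
  path = block

  private
    M : Matroid (1 + m * suc k)
    M = graphicMatroid (thetaGraph m k)

  ∈-path⁺ : ∀ R p {j} → combine p j ∈ R → j ∈ path p R
  ∈-path⁺ = ∈-block⁺

  ∈-path⁻ : ∀ R p {j} → j ∈ path p R → combine p j ∈ R
  ∈-path⁻ = ∈-block⁻ {m}

  -- The rank of `R` after contraction of the single edge, which turns the long paths into cycles of
  -- length `suc k` meeting in one vertex.
  ρ : Subset (m * suc k) → ℕ
  ρ R = sum λ p → ∣ path p R ∣ ⊓ k

  private
    module T R p = Trimming (trimming (path p R))

    -- Together with the single edge, a basis of inside ∷ R.
    trimAll : Subset (m * suc k) → Subset (m * suc k)
    trimAll R = concat (tabulate (T.trim R))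

    block-trimAll : ∀ R p → path p (trimAll R) ≡ T.trim R p
    block-trimAll R p = trans (block-concat (tabulate (T.trim R)) p) (lookup∘tabulate (T.trim R) p)

    ∈-trimAll⁺ : ∀ R p {j} → j ∈ T.trim R p → combine p j ∈ trimAll R
    ∈-trimAll⁺ R p j∈ = ∈-path⁻ (trimAll R) p (subst (_ ∈_) (sym (block-trimAll R p)) j∈)

    ∈-trimAll⁻ : ∀ R p {j} → combine p j ∈ trimAll R → j ∈ T.trim R p
    ∈-trimAll⁻ R p e∈ = subst (_ ∈_) (block-trimAll R p) (∈-path⁺ (trimAll R) p e∈)

    trimAll-⊆ : ∀ R → trimAll R ⊆ R
    trimAll-⊆ R {e} e∈ with combine-surjective {m} {suc k} e
    ... | p , j , refl = ∈-path⁻ R p (T.⊆a R p (∈-trimAll⁻ R p e∈))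

    ∣trimAll∣ : ∀ R → ∣ trimAll R ∣ ≡ ρ R
    ∣trimAll∣ R = trans (∣R∣≡∑∣block∣ {m} (trimAll R))
      (sum-cong-≗ λ p → trans (cong ∣_∣ (block-trimAll R p)) (T.size R p))

    gap∉trimAll : ∀ R p → combine p (proj₁ (T.gap R p)) ∉ trimAll R
    gap∉trimAll R p = proj₂ (T.gap R p) ∘ ∈-trimAll⁻ R p

  -- The single edge with the trimmed paths is a forest, as every path has a gap; any further edge
  -- of `R` completes a path and so a cycle through the single edge.
  rankOf-inside : ∀ R → rankOf M (inside ∷ R) ≡ suc (ρ R)
  rankOf-inside R = trans
    (rankOf-basis M {inside ∷ trimAll R} (s⊆s (trimAll-⊆ R))
      (missing-all⇒forest λ p → proj₁ (T.gap R p) , gap∉trimAll R p ∘ drop-there) maximal)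
    (cong suc (∣trimAll∣ R))
    where
    I = inside ∷ trimAll R

    maximal : ∀ {e} → e ∈ inside ∷ R → e ∉ I → ¬ Forest (thetaGraph m k) (I ∪ ⁅ e ⁆)
    maximal {e} e∈ e∉ forest with edgeView {m} {k} e
    ... | single     = contradiction here e∉
    ... | onPath p j = forest (full-path⇒cycle p (p⊆p∪q {p = I} ⁅ e ⁆ here) full)
      where
      full : ∀ i → edge p i ∈ I ∪ ⁅ edge p j ⁆
      full i with T.fill R p (∈-path⁺ R p (drop-there e∈)) (e∉ ∘ there ∘ ∈-trimAll⁺ R p) i
      ... | inj₁ refl = q⊆p∪q I _ (x∈⁅x⁆ _)
      ... | inj₂ i∈   = p⊆p∪q {p = I} ⁅ edge p j ⁆ (there (∈-trimAll⁺ R p i∈))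

  -- The edge trimmed off the full path `p` replaces the single edge in a basis, so adding the
  -- single edge to `R` cannot raise the rank.
  rankOf-outside-full : ∀ R (p : Fin m) → (∀ j → j ∈ path p R) → suc (ρ R) ≤ rankOf M (outside ∷ R)
  rankOf-outside-full R p full = subst (_≤ rankOf M (outside ∷ R))
    (trans (∣p∪⁅x⁆∣≡1+∣p∣ (trimAll R) (gap∉trimAll R p)) (cong suc (∣trimAll∣ R)))
    (rankOf-lower M {outside ∷ (trimAll R ∪ ⁅ x ⁆)} (s⊆s I⊆R)
      (missing-others⇒forest p (λ ()) λ q q≢p → proj₁ (T.gap R q) , missing q q≢p ∘ drop-there))
    where
    x : Fin (m * suc k)
    x = combine p (proj₁ (T.gap R p))

    I⊆R : trimAll R ∪ ⁅ x ⁆ ⊆ R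
    I⊆R e∈ with x∈p∪⁅y⁆⁻ (trimAll R) e∈
    ... | inj₁ e∈T = trimAll-⊆ R e∈T
    ... | inj₂ refl = ∈-path⁻ R p (full _)

    missing : ∀ q → q ≢ p → combine q (proj₁ (T.gap R q)) ∉ trimAll R ∪ ⁅ x ⁆
    missing q q≢p e∈ with x∈p∪⁅y⁆⁻ (trimAll R) e∈
    ... | inj₁ e∈T = gap∉trimAll R q e∈T
    ... | inj₂ eq  = q≢p (proj₁ (combine-injective q _ p _ eq))

  path-∪-other : ∀ R {p q} j → q ≢ p → path q (R ∪ ⁅ combine p j ⁆) ⊆ path q R
  path-∪-other R {p} {q} j q≢p j∈ with x∈p∪⁅y⁆⁻ R (∈-path⁻ (R ∪ ⁅ combine p j ⁆) q j∈)
  ... | inj₁ e∈R = ∈-path⁺ R q e∈R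
  ... | inj₂ eq  = contradiction (proj₁ (combine-injective q _ p _ eq)) q≢p

  -- Path `p` already contributes the maximum `k`, and the other paths gain no edge.
  ρ-constant : ∀ R p j → ∣ path p R ∣ ≡ k → ρ (R ∪ ⁅ combine p j ⁆) ≤ ρ R
  ρ-constant R p j ∣p∣≡k = sum-mono-≤ bound
    where
    bound : ∀ q → ∣ path q (R ∪ ⁅ combine p j ⁆) ∣ ⊓ k ≤ ∣ path q R ∣ ⊓ k
    bound q with q ≟ᶠ p
    ... | no q≢p   = ℕ.⊓-monoˡ-≤ k (p⊆q⇒∣p∣≤∣q∣ (path-∪-other R j q≢p))
    ... | yes refl = ℕ.≤-trans (ℕ.m⊓n≤n ∣ path p (R ∪ ⁅ combine p j ⁆) ∣ k)
                               (ℕ.≤-reflexive (sym (trans (cong (_⊓ k) ∣p∣≡k) (ℕ.⊓-idem k))))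

  ρ-increases : ∀ R p {j} → ∣ path p R ∣ ≢ k → j ∉ path p R → ρ R < ρ (R ∪ ⁅ combine p j ⁆)
  ρ-increases R p {j} ∣p∣≢k j∉ =
    sum-mono-< (λ q → ℕ.⊓-monoˡ-≤ k (p⊆q⇒∣p∣≤∣q∣ (block-⊆ {m} {suc k} R⊆R′ q))) {p} increase
    where
    R′ = R ∪ ⁅ combine p j ⁆

    R⊆R′ : R ⊆ R′
    R⊆R′ = p⊆p∪q _

    -- The absent edge `j` leaves at most `k` edges and `k` itself is excluded, so the minimum with
    -- `k` can still grow.
    ∣p∣<k : ∣ path p R ∣ < k
    ∣p∣<k = ℕ.≤∧≢⇒< (ℕ.≤-pred (missing⇒∣p∣<n j∉)) ∣p∣≢k

    increase : ∣ path p R ∣ ⊓ k < ∣ path p R′ ∣ ⊓ k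
    increase = subst (_< ∣ path p R′ ∣ ⊓ k) (sym (ℕ.m≤n⇒m⊓n≡m (ℕ.<⇒≤ ∣p∣<k))) (ℕ.⊓-glb
      (p⊂q⇒∣p∣<∣q∣ (block-⊆ {m} {suc k} R⊆R′ p , j , ∈-path⁺ R′ p (q⊆p∪q R _ (x∈⁅x⁆ _)) , j∉)) ∣p∣<k)

  -- A path with `k` edges lacks exactly one, and adding that one leaves the rank unchanged by
  -- `ρ-constant`.
  flat-inside⇒ : ∀ R → Flat M (inside ∷ R) → ∀ (p : Fin m) → ∣ path p R ∣ ≢ k
  flat-inside⇒ R flat p ∣p∣≡k =
    let j , j∉ = ∣p∣≢n⇒missing {p = path p R} λ eq → ℕ.1+n≢n (trans (sym eq) ∣p∣≡k)
    in ℕ.<⇒≱ (ℕ.≤-pred (subst₂ _<_ (rankOf-inside R) (rankOf-inside (R ∪ ⁅ combine p j ⁆))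
         (flat (edge p j) λ e∈ → j∉ (∈-path⁺ R p (drop-there e∈))))) (ρ-constant R p j ∣p∣≡k)

  flat-inside⇐ : ∀ R → (∀ (p : Fin m) → ∣ path p R ∣ ≢ k) → Flat M (inside ∷ R)
  flat-inside⇐ R ∣p∣≢k e = increase (edgeView {m} {k} e)
    where
    increase : ∀ {e} → EdgeView {m} {k} e → e ∉ inside ∷ R → rankOf M (inside ∷ R) < rankOf M ((inside ∷ R) ∪ ⁅ e ⁆)
    increase single       e∉ = contradiction here e∉
    increase (onPath p j) e∉ = subst₂ _<_ (sym (rankOf-inside R)) (sym (rankOf-inside (R ∪ ⁅ combine p j ⁆)))
      (s≤s (ρ-increases R p (∣p∣≢k p) λ j∈ → e∉ (there (∈-path⁻ R p j∈))))

  -- Flatness is tested at the single edge, whose ends a full path already connects.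
  flat-outside⇒ : ∀ R → Flat M (outside ∷ R) → ∀ (p : Fin m) → ∣ path p R ∣ ≢ suc k
  flat-outside⇒ R flat p ∣p∣≡ = ℕ.<⇒≱ (flat zero λ ())
    (subst (_≤ rankOf M (outside ∷ R))
      (trans (sym (rankOf-inside R)) (cong (λ S → rankOf M (inside ∷ S)) (sym (∪-identityʳ R))))
      (rankOf-outside-full R p λ j → subst (j ∈_) (sym (∣p∣≡n⇒p≡⊤ ∣p∣≡)) ∈⊤))

  module _ (R : Subset (m * suc k)) (∣p∣≢1+k : ∀ (p : Fin m) → ∣ path p R ∣ ≢ suc k) where

    private
      missing : ∀ p → Missing {m} {k} (outside ∷ R) p
      missing p = let j , j∉ = ∣p∣≢n⇒missing (∣p∣≢1+k p) in j , λ e∈ → j∉ (∈-path⁺ R p (drop-there e∈))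

    rankOf-outside : rankOf M (outside ∷ R) ≡ ∣ R ∣
    rankOf-outside = rankOf-indep M (missing-all⇒forest missing)

    -- Every extension by one edge is still a forest: the single edge leaves a gap in each path, and
    -- an edge of path `p` can complete at most `p`. So the rank grows with the size.
    flat-outside⇐ : Flat M (outside ∷ R)
    flat-outside⇐ e e∉ = subst₂ _<_ (sym rankOf-outside)
      (sym (trans (rankOf-indep M (independent e)) (∣p∪⁅x⁆∣≡1+∣p∣ (outside ∷ R) e∉))) ℕ.≤-refl
      where
      independent : ∀ e → Forest (thetaGraph m k) ((outside ∷ R) ∪ ⁅ e ⁆)
      independent e with edgeView {m} {k} e
      ... | single     = missing-all⇒forest λ p → let j , j∉ = missing p in
                           j , λ e∈ → j∉ (there (subst (combine p j ∈_) (∪-identityʳ R) (drop-there e∈)))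
      ... | onPath p i = missing-others⇒forest p (λ ()) other
        where
        other : ∀ q → q ≢ p → Missing ((outside ∷ R) ∪ ⁅ edge p i ⁆) q
        other q q≢p with missing q
        ... | j , j∉ = j , λ e∈ → stillMissing (x∈p∪⁅y⁆⁻ (outside ∷ R) e∈)
          where
          stillMissing : ¬ (edge q j ∈ outside ∷ R ⊎ edge q j ≡ edge p i)
          stillMissing (inj₁ e∈) = j∉ e∈
          stillMissing (inj₂ eq) = q≢p (proj₁ (edge-injective eq))

-- Counting

#_ : ∀ {n} {P : Pred (Subset n) 0ℓ} → Decidable P → ℕ
#_ {n} P? = length (filter P? (subsets n))

#-cong : ∀ {n} {P Q : Pred (Subset n) 0ℓ} (P? : Decidable P) (Q? : Decidable Q) →
         (∀ {S} → P S → Q S) → (∀ {S} → Q S → P S) → # P? ≡ # Q?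
#-cong {n} P? Q? P⇒Q Q⇒P = cong length (List.filter-≐ P? Q? (P⇒Q , Q⇒P) (subsets n))

#-none : ∀ {n} {P : Pred (Subset n) 0ℓ} (P? : Decidable P) → (∀ S → ¬ P S) → # P? ≡ 0
#-none {n} P? ¬P = cong length (List.filter-none P? (AllList.universal ¬P (subsets n)))

length-filter-map : ∀ {A B : Set} {P : Pred B 0ℓ} (P? : Decidable P) (f : A → B) xs →
                    length (filter P? (List.map f xs)) ≡ length (filter (P? ∘ f) xs)
length-filter-map P? f List.[]       = refl
length-filter-map P? f (x List.∷ xs) with does (P? (f x))
... | true  = cong suc (length-filter-map P? f xs)
... | false = length-filter-map P? f xs

#-[] : {P : Pred (Subset 0) 0ℓ} (P? : Decidable P) → # P? ≡ (if does (P? []) then 1 else 0)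
#-[] P? with does (P? [])
... | true  = refl
... | false = refl

#-∷ : ∀ {n} {P : Pred (Subset (suc n)) 0ℓ} (P? : Decidable P) →
      # P? ≡ # (P? ∘ (outside ∷_)) + # (P? ∘ (inside ∷_))
#-∷ {n} P? = trans (cong length (List.filter-++ P? (List.map (outside ∷_) (subsets n)) _))
  (trans (List.length-++ (filter P? (List.map (outside ∷_) (subsets n))))
    (cong₂ _+_ (length-filter-map P? (outside ∷_) (subsets n)) (length-filter-map P? (inside ∷_) (subsets n))))

-- Pascal's rule summed against `g`. The last sum has one term less because its index is shifted by
-- one.
pascal : ∀ n N (g : ℕ → ℕ) →
         sum {suc N} (λ s → (suc n C toℕ s) * g (toℕ s)) ≡
         sum {suc N} (λ s → (n C toℕ s) * g (toℕ s)) + sum {N} (λ s → (n C toℕ s) * g (suc (toℕ s)))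
pascal n N g = begin
  1 * g 0 + sum {N} (λ s → (suc n C suc (toℕ s)) * g (suc (toℕ s)))
    ≡⟨ cong (1 * g 0 +_) (sum-cong-≗ {N} λ s → trans
         (cong (_* g (suc (toℕ s))) (sym (trans (ℕ.+-comm (n C suc (toℕ s)) _) (nCk+nC[k+1]≡[n+1]C[k+1] n (toℕ s)))))
         (ℕ.*-distribʳ-+ (g (suc (toℕ s))) (n C suc (toℕ s)) (n C toℕ s))) ⟩
  1 * g 0 + sum {N} (λ s → (n C suc (toℕ s)) * g (suc (toℕ s)) + (n C toℕ s) * g (suc (toℕ s)))
    ≡⟨ cong (1 * g 0 +_) (∑-distrib-+ {N} (λ s → (n C suc (toℕ s)) * g (suc (toℕ s))) _) ⟩
  1 * g 0 + (sum {N} (λ s → (n C suc (toℕ s)) * g (suc (toℕ s))) + sum {N} (λ s → (n C toℕ s) * g (suc (toℕ s))))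
    ≡⟨ ℕ.+-assoc (1 * g 0) _ _ ⟨
  1 * g 0 + sum {N} (λ s → (n C suc (toℕ s)) * g (suc (toℕ s))) + sum {N} (λ s → (n C toℕ s) * g (suc (toℕ s)))
    ∎
  where open ≡-Reasoning

-- Groups subsets by the size of their first `n` coordinates. Any `N` above `n` is allowed, the
-- extra binomials being zero, because the two recursive calls need sums of different lengths.
#-++ : ∀ n {l N} → n < N → {P : Pred (Subset (n + l)) 0ℓ} (P? : Decidable P) (g : ℕ → ℕ) →
       (∀ (a : Subset n) → # (P? ∘ (a ++_)) ≡ g ∣ a ∣) → # P? ≡ sum {N} λ s → (n C toℕ s) * g (toℕ s)
#-++ zero {N = suc N} _ P? g count = trans (count []) (sym (trans
  (cong₂ _+_ (ℕ.+-identityʳ (g 0)) (sum-zero {N} λ _ → refl)) (ℕ.+-identityʳ (g 0))))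
#-++ (suc n) {N = suc N} (s≤s n<N) P? g count = trans (#-∷ P?) (trans
  (cong₂ _+_ (#-++ n (ℕ.m≤n⇒m≤1+n n<N) (P? ∘ (outside ∷_)) g (count ∘ (outside ∷_)))
             (#-++ n n<N (P? ∘ (inside ∷_)) (g ∘ suc) (count ∘ (inside ∷_))))
  (sym (pascal n N g)))

-- Subsets with prescribed block sizes

module _ {Valid : Pred ℕ 0ℓ} (valid? : Decidable Valid) {weight : ℕ → ℕ} (weight≤ : ∀ s → weight s ≤ s) (n : ℕ) where

  -- The common form of both kinds of flats: `Valid` restricts the number of edges on each path, and
  -- `weight` is the path's share of the rank.
  Fits : ∀ m → ℕ → Pred (Subset (m * n)) 0ℓ
  Fits m i R = (∀ p → Valid ∣ block {m} {n} p R ∣) × sum (λ p → weight ∣ block {m} {n} p R ∣) ≡ i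

  fits? : ∀ m i → Decidable (Fits m i)
  fits? m i R = all? (λ p → valid? ∣ block {m} {n} p R ∣) ×-dec (sum (λ p → weight ∣ block {m} {n} p R ∣) ℕ.≟ i)

  Fits⇒≤ : ∀ {m i} {R : Subset (m * n)} → Fits m i R → i ≤ m * n
  Fits⇒≤ {m} {i} {R} (_ , refl) = ℕ.≤-trans (sum-mono-≤ {m} λ p → weight≤ ∣ block {m} {n} p R ∣)
    (ℕ.≤-trans (ℕ.≤-reflexive (sym (∣R∣≡∑∣block∣ {m} R))) (∣p∣≤n R))

  Contributes : ℕ → ℕ → Pred ℕ 0ℓ
  Contributes m i s = weight s ≤ i × i ∸ weight s ≤ m * n × Valid s

  contributes? : ∀ m i → Decidable (Contributes m i)
  contributes? m i s = (weight s ℕ.≤? i) ×-dec (i ∸ weight s ℕ.≤? m * n) ×-dec valid? s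

  -- The coefficient of xⁱ in (∑ₛ C(n,s) x^(weight s))ᵐ, the sum being over valid s ≤ n.
  -- The condition i ∸ weight s ≤ m * n only discards zero terms; it keeps the
  -- evaluation near the top degree small.
  fitCount : ℕ → ℕ → ℕ
  fitCount zero    i = if does (0 ℕ.≟ i) then 1 else 0
  fitCount (suc m) i = sum {suc n} λ s → (n C toℕ s) *
    (if does (contributes? m i (toℕ s)) then fitCount m (i ∸ weight (toℕ s)) else 0)

  module _ {m i : ℕ} (a : Subset n) {R : Subset (m * n)} where

    Fits-++⁻ : Fits (suc m) i (a ++ R) →
               Contributes m i ∣ a ∣ × Fits m (i ∸ weight ∣ a ∣) R
    Fits-++⁻ (valid , refl) =
      ( subst (_≤ w + ws) w≡ (ℕ.m≤m+n w ws)
      -- The truncation loses nothing: the remaining blocks carry at most `m * n`.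
      , Fits⇒≤ {m} {R = R} rest
      , subst (Valid ∘ ∣_∣) (block-zero-++ {m} a R) (valid zero) ) , rest
      where
      w  = weight ∣ block {suc m} {n} zero (a ++ R) ∣
      ws = sum λ p → weight ∣ block {suc m} {n} (suc p) (a ++ R) ∣

      w≡ : w ≡ weight ∣ a ∣
      w≡ = cong (weight ∘ ∣_∣) (block-zero-++ {m} a R)

      rest : Fits m (w + ws ∸ weight ∣ a ∣) R
      rest = (λ p → subst (Valid ∘ ∣_∣) (block-suc-++ {m} a R p) (valid (suc p))) ,
        trans (sum-cong-≗ λ p → cong (weight ∘ ∣_∣) (sym (block-suc-++ {m} a R p)))
              (sym (trans (cong (w + ws ∸_) (sym w≡)) (ℕ.m+n∸m≡n w ws)))

    Fits-++⁺ : Contributes m i ∣ a ∣ → Fits m (i ∸ weight ∣ a ∣) R → Fits (suc m) i (a ++ R)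
    Fits-++⁺ (w≤i , _ , valid-a) (valid , eq) =
      (λ { zero    → subst (Valid ∘ ∣_∣) (sym (block-zero-++ {m} a R)) valid-a
         ; (suc p) → subst (Valid ∘ ∣_∣) (sym (block-suc-++ {m} a R p)) (valid p) }) ,
      trans (cong₂ _+_ (cong (weight ∘ ∣_∣) (block-zero-++ {m} a R))
                       (trans (sum-cong-≗ λ p → cong (weight ∘ ∣_∣) (block-suc-++ {m} a R p)) eq))
            (ℕ.m+[n∸m]≡n w≤i)

  #-fits : ∀ m i → # (fits? m i) ≡ fitCount m i
  #-fits zero    i = #-[] (fits? zero i)
  #-fits (suc m) i = #-++ n ℕ.≤-refl (fits? (suc m) i)
    (λ s → if does (contributes? m i s) then fitCount m (i ∸ weight s) else 0) count
    where
    -- If the first block contributes, its completions are the fitting sets for the remaining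
    -- weight; otherwise it has none.
    count : ∀ (a : Subset n) → # (fits? (suc m) i ∘ (a ++_)) ≡
                  (if does (contributes? m i ∣ a ∣) then fitCount m (i ∸ weight ∣ a ∣) else 0)
    count a = byCases (contributes? m i ∣ a ∣)
      where
      byCases : (d : Dec (Contributes m i ∣ a ∣)) →
               # (fits? (suc m) i ∘ (a ++_)) ≡ (if does d then fitCount m (i ∸ weight ∣ a ∣) else 0)
      byCases (yes ok) = trans
        (#-cong (fits? (suc m) i ∘ (a ++_)) (fits? m (i ∸ weight ∣ a ∣)) (proj₂ ∘ Fits-++⁻ {m} a) (Fits-++⁺ {m} a ok))
        (#-fits m (i ∸ weight ∣ a ∣))
      byCases (no ¬ok) = #-none (fits? (suc m) i ∘ (a ++_)) λ R fits → ¬ok (proj₁ (Fits-++⁻ {m} a fits))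

-- Numbers of flats of theta graphs

module _ (m k : ℕ) where

  private
    M : Matroid (1 + m * suc k)
    M = graphicMatroid (thetaGraph m k)

    flatOfRank? : ∀ i → Decidable (λ F → Flat M F × rankOf M F ≡ i)
    flatOfRank? i F = flat? M F ×-dec (rankOf M F ℕ.≟ i)

    notFull? : Decidable (_≢ suc k)
    notFull? s = ¬? (s ℕ.≟ suc k)

    notAlmostFull? : Decidable (_≢ k)
    notAlmostFull? s = ¬? (s ℕ.≟ k)

  -- The coefficients of Aᵐ and Bᵐ. The weight is inferred from the inequality supplied: `s` in the
  -- first case, `s ⊓ k` in the second.
  flatsAvoiding flatsContaining : ℕ → ℕ
  flatsAvoiding   = fitCount notFull? (λ _ → ℕ.≤-refl) (suc k) m
  flatsContaining = fitCount notAlmostFull? (λ s → ℕ.m⊓n≤m s k) (suc k) m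

  -- Splits the flats by the single edge, which takes up one unit of rank when present; hence the
  -- index `i` in the second count.
  W-theta : ∀ i → W (graphicMatroid (thetaGraph m k)) (suc i) ≡ flatsAvoiding (suc i) + flatsContaining i
  W-theta i = trans (#-∷ (flatOfRank? (suc i))) (cong₂ _+_
    (trans avoiding (#-fits notFull? (λ _ → ℕ.≤-refl) (suc k) m (suc i)))
    (trans containing (#-fits notAlmostFull? (λ s → ℕ.m⊓n≤m s k) (suc k) m i)))
    where
    avoiding : # (flatOfRank? (suc i) ∘ (outside ∷_)) ≡ # (fits? notFull? (λ _ → ℕ.≤-refl) (suc k) m (suc i))
    avoiding = #-cong (flatOfRank? (suc i) ∘ (outside ∷_)) (fits? notFull? (λ _ → ℕ.≤-refl) (suc k) m (suc i))
      (λ {R} (flat , rank≡) → let full≢ = flat-outside⇒ {m} {k} R flat in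
        full≢ , trans (sym (∣R∣≡∑∣block∣ {m} R)) (trans (sym (rankOf-outside {m} {k} R full≢)) rank≡))
      (λ {R} (full≢ , sum≡) → flat-outside⇐ {m} {k} R full≢ ,
        trans (rankOf-outside {m} {k} R full≢) (trans (∣R∣≡∑∣block∣ {m} R) sum≡))

    containing : # (flatOfRank? (suc i) ∘ (inside ∷_)) ≡ # (fits? notAlmostFull? (λ s → ℕ.m⊓n≤m s k) (suc k) m i)
    containing = #-cong (flatOfRank? (suc i) ∘ (inside ∷_)) (fits? notAlmostFull? (λ s → ℕ.m⊓n≤m s k) (suc k) m i)
      (λ {R} (flat , rank≡) → flat-inside⇒ {m} {k} R flat ,
        ℕ.suc-injective (trans (sym (rankOf-inside {m} {k} R)) rank≡))
      (λ {R} (almost≢ , sum≡) → flat-inside⇐ {m} {k} R almost≢ ,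
        trans (rankOf-inside {m} {k} R) (cong suc sum≡))

  rank-theta : rank (graphicMatroid (thetaGraph m k)) ≡ suc (ρ {m} {k} ⊤)
  rank-theta = rankOf-inside {m} {k} ⊤

-- Stated for arbitrary W, so that checking it never evaluates the numbers of
-- flats of the matroid by enumerating its 2⁷⁹ sets of edges.
log-concavity-failure : ∀ (W a b : ℕ → ℕ) {r} → r ≡ 76 → (∀ i → W (suc i) ≡ a (suc i) + b i) →
                        a 73 + b 72 ≡ 52954525 → a 74 + b 73 ≡ 983775 → a 75 + b 74 ≡ 18551 →
                        ∃[ i ] (1 ≤ i × i ≤ r ∸ 1 × W i ^ 2 < W (i ∸ 1) * W (i + 1))
log-concavity-failure W a b refl W≡ W₇₃ W₇₄ W₇₅ = 74 , ℕ.≤ᵇ⇒≤ 1 74 _ , ℕ.≤ᵇ⇒≤ 74 75 _ ,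
  subst₂ _<_ (cong (_^ 2) (sym (trans (W≡ 73) W₇₄)))
             (cong₂ _*_ (sym (trans (W≡ 72) W₇₃)) (sym (trans (W≡ 74) W₇₅)))
    -- The two sides are 967813250625 and 982359393275.
    (ℕ.<ᵇ⇒< (983775 ^ 2) (52954525 * 18551) _)

theorem2p3 :
    let M = graphicMatroid (thetaGraph 3 25)
        r = rank M
    in ∃[ i ] (1 ≤ i × i ≤ r ∸ 1 × W M i ^ 2 < W M (i ∸ 1) * W M (i + 1))
theorem2p3 = log-concavity-failure (W (graphicMatroid (thetaGraph 3 25)))
  (flatsAvoiding 3 25) (flatsContaining 3 25)
  -- The first `refl` evaluates `suc (ρ ⊤)` to 1 + 3 * 25 = 76; the last three evaluate the
  -- coefficient sums for W₇₃, W₇₄ and W₇₅.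
  (trans (rank-theta 3 25) refl) (W-theta 3 25) refl refl refl
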